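{- The logic $\mathsf{GS4^c}$ has the finite birelational frame property (for every formula $\varphi$ of $\mathcal L$, if $\varphi$ is falsifiable, respectively satisfiable, on some $\mathsf{GS4^c}$ frame, then it is falsifiable, respectively satisfiable, on some finite $\mathsf{GS4^c}$ frame), and hence $\mathsf{GS4^c}$ is decidable (membership of a given formula in $\mathsf{GS4^c}$ is decidable).
   Context: Fix a countably infinite set $\mathbb P$ of propositional variables. The language $\mathcal L$: $\varphi ::= p \mid \bot \mid (\varphi\wedge\varphi)\mid(\varphi\vee\varphi)\mid(\varphi\to\varphi)\mid\Diamond\varphi\mid\Box\varphi$, $p\in\mathbb P$; $\neg\varphi:=\varphi\to\bot$. A logic is a set of formulas closed under substitution. $\mathsf{CS4}$ is the smallest logic containing all intuitionistic propositional tautologies (in $\mathcal L$) and the axioms $\Box(p\to q)\to(\Box p\to\Box q)$, $\Box(p\to q)\to(\Diamond p\to\Diamond q)$, $\Box p\to p$, $p\to\Diamond p$, $\Diamond\Diamond p\to\Diamond p$, $\Box p\to\Box\Box p$, and closed under modus ponens and necessitation (from $\varphi$ infer $\Box\varphi$). $\mathsf{GS4^c}$ is the smallest such logic extending $\mathsf{CS4}$ that also contains $\Diamond(p\vee q)\to\Diamond p\vee\Diamond q$, $\neg\Diamond\bot$, $(\Diamond p\to\Box q)\to\Box(p\to q)$, $(p\to q)\vee(q\to p)$ and $\Box(p\vee q)\to\Box p\vee\Diamond q$. A bi-intuitionistic frame $(W,W^\bot,\preccurlyeq,\sqsubseteq)$: $\preccurlyeq,\sqsubseteq$ preorders on $W$,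 $W^\bot\subseteq W$ closed upward under both; infallible if $W^\bot=\varnothing$. Forth--up confluent: $w\preccurlyeq w'$, $w\sqsubseteq v$ imply some $v'$ with $v\preccurlyeq v'$, $w'\sqsubseteq v'$. Back--up confluent: $w\sqsubseteq v\preccurlyeq v'$ implies some $w'$ with $w\preccurlyeq w'\sqsubseteq v'$. Forth--down confluent: $w\preccurlyeq v\sqsubseteq v'$ implies some $w'$ with $w\sqsubseteq w'\preccurlyeq v'$. Upward linear: $w\preccurlyeq u$, $w\preccurlyeq v$ imply $u\preccurlyeq v$ or $v\preccurlyeq u$. A $\mathsf{GS4^c}$ frame is an infallible bi-intuitionistic frame that is forth--up, back--up and forth--down confluent and upward linear. Valuations $V:\mathbb P\to2^W$ have each $V(p)$ $\preccurlyeq$-upward closed and containing $W^\bot$. Satisfaction: $w\models p$ iff $w\in V(p)$; $w\models\bot$ iff $w\in W^\bot$; $\wedge,\vee$ pointwise; $w\models\varphi\to\psi$ iff for all $v\succcurlyeq w$, $v\models\varphi$ implies $v\models\psi$; $w\models\Diamond\varphi$ iff for all $u\succcurlyeq w$ there is $v\sqsupseteq u$ with $v\models\varphi$; $w\models\Box\varphi$ iff for all $u,v$ with $w\preccurlyeq u\sqsubseteq v$, $v\models\varphi$. Falsifiable / satisfiable on a frame: for some valuation, some world outside $W^\bot$ fails / satisfies $\varphi$. -}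

module Defs where

open import Data.Nat using (ℕ)
open import Data.Fin using (Fin)
open import Data.Bool using (Bool; true)
open import Data.Product using (Σ; Σ-syntax; _×_)
open import Data.Sum using (_⊎_)
open import Data.Empty using (⊥)
open import Relation.Nullary using (¬_; Dec)
open import Relation.Binary.PropositionalEquality using (_≡_)

data Fm : Set where
  var  : ℕ → Fm
  fbot : Fm
  _⋀_  : Fm → Fm → Fm
  _⋁_  : Fm → Fm → Fm
  _⇒_  : Fm → Fm → Fm
  ◇_   : Fm → Fm
  □_   : Fm → Fm

infixr 6 _⋀_
infixr 5 _⋁_
infixr 4 _⇒_
infix  7 ◇_ □_

¬f_ : Fm → Fm
¬f φ = φ ⇒ fbot

sub : (ℕ → Fm) → Fm → Fm
sub σ (var p)  = σ p
sub σ fbot     = fbot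
sub σ (φ ⋀ ψ)  = sub σ φ ⋀ sub σ ψ
sub σ (φ ⋁ ψ)  = sub σ φ ⋁ sub σ ψ
sub σ (φ ⇒ ψ)  = sub σ φ ⇒ sub σ ψ
sub σ (◇ φ)    = ◇ sub σ φ
sub σ (□ φ)    = □ sub σ φ

-- The logic GS4ᶜ: smallest set of formulas containing the listed axioms
-- (stated with the concrete variables p , q , r), closed under
-- modus ponens, necessitation and uniform substitution.
-- "All intuitionistic propositional tautologies" are obtained from a
-- standard Hilbert axiomatisation of IPC (axioms ipc1–ipc9) together with
-- modus ponens and substitution.

p q r : Fm
p = var 0
q = var 1
r = var 2

data GS4c : Fm → Set where
  ipc1 : GS4c (p ⇒ (q ⇒ p))
  ipc2 : GS4c ((p ⇒ (q ⇒ r)) ⇒ ((p ⇒ q) ⇒ (p ⇒ r)))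
  ipc3 : GS4c ((p ⋀ q) ⇒ p)
  ipc4 : GS4c ((p ⋀ q) ⇒ q)
  ipc5 : GS4c (p ⇒ (q ⇒ (p ⋀ q)))
  ipc6 : GS4c (p ⇒ (p ⋁ q))
  ipc7 : GS4c (q ⇒ (p ⋁ q))
  ipc8 : GS4c ((p ⇒ r) ⇒ ((q ⇒ r) ⇒ ((p ⋁ q) ⇒ r)))
  ipc9 : GS4c (fbot ⇒ p)
  K□   : GS4c (□ (p ⇒ q) ⇒ (□ p ⇒ □ q))
  K◇   : GS4c (□ (p ⇒ q) ⇒ (◇ p ⇒ ◇ q))
  T□   : GS4c (□ p ⇒ p)
  T◇   : GS4c (p ⇒ ◇ p)
  4◇   : GS4c (◇ ◇ p ⇒ ◇ p)
  4□   : GS4c (□ p ⇒ □ □ p)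
  C◇   : GS4c (◇ (p ⋁ q) ⇒ (◇ p ⋁ ◇ q))
  N◇   : GS4c (¬f (◇ fbot))
  FS   : GS4c ((◇ p ⇒ □ q) ⇒ □ (p ⇒ q))
  GD   : GS4c ((p ⇒ q) ⋁ (q ⇒ p))
  CD   : GS4c (□ (p ⋁ q) ⇒ (□ p ⋁ ◇ q))
  mp   : ∀ {φ ψ} → GS4c (φ ⇒ ψ) → GS4c φ → GS4c ψ
  nec  : ∀ {φ} → GS4c φ → GS4c (□ φ)
  subst : ∀ {φ} (σ : ℕ → Fm) → GS4c φ → GS4c (sub σ φ)

record Frame (W : Set) : Set₁ where
  field
    W⊥     : W → Set
    _≼_    : W → W → Set
    _⊑_    : W → W → Set
    ≼-refl  : ∀ {w} → w ≼ w
    ≼-trans : ∀ {u v w} → u ≼ v → v ≼ w → u ≼ w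
    ⊑-refl  : ∀ {w} → w ⊑ w
    ⊑-trans : ∀ {u v w} → u ⊑ v → v ⊑ w → u ⊑ w
    W⊥-≼   : ∀ {w v} → w ≼ v → W⊥ w → W⊥ v
    W⊥-⊑   : ∀ {w v} → w ⊑ v → W⊥ w → W⊥ v

module _ {W : Set} (F : Frame W) where
  open Frame F

  Infallible : Set
  Infallible = ∀ w → ¬ W⊥ w

  ForthUp : Set
  ForthUp = ∀ {w w' v} → w ≼ w' → w ⊑ v → Σ[ v' ∈ W ] (v ≼ v' × w' ⊑ v')

  BackUp : Set
  BackUp = ∀ {w v v'} → w ⊑ v → v ≼ v' → Σ[ w' ∈ W ] (w ≼ w' × w' ⊑ v')

  ForthDown : Set
  ForthDown = ∀ {w v v'} → w ≼ v → v ⊑ v' → Σ[ w' ∈ W ] (w ⊑ w' × w' ≼ v')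

  UpwardLinear : Set
  UpwardLinear = ∀ {w u v} → w ≼ u → w ≼ v → (u ≼ v) ⊎ (v ≼ u)

  IsGS4cFrame : Set
  IsGS4cFrame = Infallible × ForthUp × BackUp × ForthDown × UpwardLinear

  record Valuation : Set₁ where
    field
      V      : ℕ → W → Set
      V-mono : ∀ {x w v} → w ≼ v → V x w → V x v
      V-⊥    : ∀ {x w} → W⊥ w → V x w

  Sat : Valuation → W → Fm → Set
  Sat Val w (var x)  = Valuation.V Val x w
  Sat Val w fbot     = W⊥ w
  Sat Val w (φ ⋀ ψ)  = Sat Val w φ × Sat Val w ψ
  Sat Val w (φ ⋁ ψ)  = Sat Val w φ ⊎ Sat Val w ψ
  Sat Val w (φ ⇒ ψ)  = ∀ v → w ≼ v → Sat Val v φ → Sat Val v ψ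
  Sat Val w (◇ φ)    = ∀ u → w ≼ u → Σ[ v ∈ W ] (u ⊑ v × Sat Val v φ)
  Sat Val w (□ φ)    = ∀ u v → w ≼ u → u ⊑ v → Sat Val v φ

  Falsifiable : Fm → Set₁
  Falsifiable φ = Σ[ Val ∈ Valuation ] Σ[ w ∈ W ] (¬ W⊥ w × ¬ Sat Val w φ)

  Satisfiable : Fm → Set₁
  Satisfiable φ = Σ[ Val ∈ Valuation ] Σ[ w ∈ W ] (¬ W⊥ w × Sat Val w φ)

OnSomeGS4cFrame : (∀ {W : Set} → Frame W → Fm → Set₁) → Fm → Set₁
OnSomeGS4cFrame P φ = Σ[ W ∈ Set ] Σ[ F ∈ Frame W ] (IsGS4cFrame F × P F φ)

OnSomeFiniteGS4cFrame : (∀ {W : Set} → Frame W → Fm → Set₁) → Fm → Set₁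
OnSomeFiniteGS4cFrame P φ = Σ[ n ∈ ℕ ] Σ[ F ∈ Frame (Fin n) ] (IsGS4cFrame F × P F φ)

FiniteFrameProperty : Set₁
FiniteFrameProperty =
  (∀ φ → OnSomeGS4cFrame Falsifiable φ → OnSomeFiniteGS4cFrame Falsifiable φ)
  × (∀ φ → OnSomeGS4cFrame Satisfiable φ → OnSomeFiniteGS4cFrame Satisfiable φ)

LEM : Set₁
LEM = ∀ (A : Set) → Dec A

-- Decidability: a total (hence computable) Agda function d deciding
-- membership, whose correctness is established in classical metatheory.
DecidesGS4c : (Fm → Bool) → Set₁
DecidesGS4c d = LEM → ∀ φ → (d φ ≡ true → GS4c φ) × (GS4c φ → d φ ≡ true)

{-# OPTIONS --safe #-}
-- Completeness: prime theories, ordered by inclusion and by Γ ⊑ Δ iff □⁻¹Γ ⊆ Δ ⊆ ◇⁻¹Γ, form a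
-- GS4ᶜ frame, each confluence condition coming from one of the axioms of the logic.
--
-- Finite frames: let Φ be the set of subformulas of φ. Identifying worlds with the same Φ-types
-- in their ≼-cones destroys forth–down confluence, because ≼-predecessors are not unique. So the
-- new worlds are pairs x ≼ u, described by the set of Φ-types of the ≼-cone of x and the Φ-type of u.
-- Given x ⊑ y, a pair (x , u) may see (y , v) when u ⊑ v' for some v' ≽ v and u' ⊑ v for some
-- u' ≽ u. By upward linearity this relation is still confluent downwards, and it transports
-- □-formulas forwards and ◇-formulas backwards; both facts survive closing it under equality of
-- descriptions and transitivity. There are at most 2^2^|Φ| · 2^|Φ| descriptions, so validity, and
-- with it membership in the logic, is decided by checking all frames of exactly that size.
module Submission where

open import Defs
open import Data.Bool using (Bool; true; T)
open import Data.Bool.Properties using (T?)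
open import Data.Empty using (⊥; ⊥-elim)
open import Data.Fin.Base using (Fin; zero; suc; toℕ; fromℕ<; combine; remQuot; finToFun; funToFin)
open import Data.Fin.Properties
  using (all?; any?; _≟_; toℕ-fromℕ<; remQuot-combine; combine-injective; finToFun-funToFin)
open import Data.List.Base using (List; []; _∷_; _++_; foldl; map; cartesianProductWith; length; lookup)
open import Data.List.Membership.Propositional using (_∈_)
open import Data.List.Membership.Propositional.Properties
  using (∈-++⁺ˡ; ∈-++⁺ʳ; ∈-++⁻; ∈-map⁺; ∈-cartesianProductWith⁺)
open import Data.List.Relation.Unary.Any using (here; there; index)
open import Data.List.Relation.Unary.Any.Properties using (lookup-index)
open import Data.Nat.Base using (ℕ; zero; suc; _+_; _*_; _^_; _<_; _⊔_; _≤′_; ≤′-refl; ≤′-step)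
open import Data.Nat.Properties using (≤⇒≤′; m≤m⊔n; m≤n⊔m; m≤m+n; m≤n+m; ≤-trans; ≤-refl)
  renaming (_≟_ to _≟ℕ_)
open import Data.Product using (Σ; Σ-syntax; ∃; ∃-syntax; _×_; _,_; proj₁; proj₂; uncurry)
open import Data.Sum as Sum using (_⊎_; inj₁; inj₂; [_,_]′)
open import Function.Base using (_∘_; id)
open import Function.Bundles using (_⇔_; mk⇔; module Equivalence)
open import Level using (0ℓ)
open import Relation.Binary.Construct.Closure.ReflexiveTransitive using (Star; ε; _◅_; _◅◅_)
open import Relation.Binary.PropositionalEquality using (_≡_; refl; sym; trans)
  renaming (subst to ≡-subst)
open import Relation.Nullary using (¬_; Dec; yes; no)
open import Relation.Nullary.Decidable
  using (⌊_⌋; toWitness; fromWitness; does; dec-true; map′; _×-dec_; _⊎-dec_; _→-dec_; decidable-stable)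
open import Relation.Unary using (Pred; _⊆_; _∪_; ∅; ｛_｝)
open Equivalence using (to; from)

-- Persistence and soundness

module _ {W : Set} (F : Frame W) where
  open Frame F

  persistent : (Val : Valuation F) (φ : Fm) {w v : W} → w ≼ v → Sat F Val w φ → Sat F Val v φ
  persistent Val (var x)  wv s        = Valuation.V-mono Val wv s
  persistent Val fbot     wv s        = W⊥-≼ wv s
  persistent Val (φ ⋀ ψ)  wv (s , t)  = persistent Val φ wv s , persistent Val ψ wv t
  persistent Val (φ ⋁ ψ)  wv (inj₁ s) = inj₁ (persistent Val φ wv s)
  persistent Val (φ ⋁ ψ)  wv (inj₂ s) = inj₂ (persistent Val ψ wv s)
  persistent Val (φ ⇒ ψ)  wv s        = λ u vu → s u (≼-trans wv vu)
  persistent Val (◇ φ)    wv s        = λ u vu → s u (≼-trans wv vu)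
  persistent Val (□ φ)    wv s        = λ u a vu → s u a (≼-trans wv vu)

module GS4cFrame {W : Set} (F : Frame W) (isG : IsGS4cFrame F) where
  open Frame F

  infallible : Infallible F
  infallible = proj₁ isG

  forthUp : ForthUp F
  forthUp = proj₁ (proj₂ isG)

  backUp : BackUp F
  backUp = proj₁ (proj₂ (proj₂ isG))

  forthDown : ForthDown F
  forthDown = proj₁ (proj₂ (proj₂ (proj₂ isG)))

  linear : UpwardLinear F
  linear = proj₂ (proj₂ (proj₂ (proj₂ isG)))

  -- Forth-up confluence lifts the witness along every `w ≼ u`, so a single ⊑-successor of `w`
  -- suffices.
  ◇-intro : (Val : Valuation F) (φ : Fm) {w v : W} → w ⊑ v → Sat F Val v φ → Sat F Val w (◇ φ)
  ◇-intro Val φ wv s u wu =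
    let v' , vv' , uv' = forthUp wu wv in v' , uv' , persistent F Val φ vv' s

module Soundness (lem : LEM) {W : Set} (F : Frame W) (isG : IsGS4cFrame F) where
  open Frame F
  open GS4cFrame F isG

  substVal : (ℕ → Fm) → Valuation F → Valuation F
  substVal σ Val = record
    { V      = λ x w → Sat F Val w (σ x)
    ; V-mono = λ {x} → persistent F Val (σ x)
    ; V-⊥    = λ {_} {w} b → ⊥-elim (infallible w b)
    }

  substVal⇒ : ∀ σ Val φ {w} → Sat F (substVal σ Val) w φ → Sat F Val w (sub σ φ)
  substVal⇐ : ∀ σ Val φ {w} → Sat F Val w (sub σ φ) → Sat F (substVal σ Val) w φ
  substVal⇒ σ Val (var x) s        = s
  substVal⇒ σ Val fbot    s        = s
  substVal⇒ σ Val (φ ⋀ ψ) (s , t)  = substVal⇒ σ Val φ s , substVal⇒ σ Val ψ t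
  substVal⇒ σ Val (φ ⋁ ψ) (inj₁ s) = inj₁ (substVal⇒ σ Val φ s)
  substVal⇒ σ Val (φ ⋁ ψ) (inj₂ s) = inj₂ (substVal⇒ σ Val ψ s)
  substVal⇒ σ Val (φ ⇒ ψ) s        = λ v wv t → substVal⇒ σ Val ψ (s v wv (substVal⇐ σ Val φ t))
  substVal⇒ σ Val (◇ φ)   s        = λ u wu → let v , uv , t = s u wu in v , uv , substVal⇒ σ Val φ t
  substVal⇒ σ Val (□ φ)   s        = λ u v wu uv → substVal⇒ σ Val φ (s u v wu uv)
  substVal⇐ σ Val (var x) s        = s
  substVal⇐ σ Val fbot    s        = s
  substVal⇐ σ Val (φ ⋀ ψ) (s , t)  = substVal⇐ σ Val φ s , substVal⇐ σ Val ψ t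
  substVal⇐ σ Val (φ ⋁ ψ) (inj₁ s) = inj₁ (substVal⇐ σ Val φ s)
  substVal⇐ σ Val (φ ⋁ ψ) (inj₂ s) = inj₂ (substVal⇐ σ Val ψ s)
  substVal⇐ σ Val (φ ⇒ ψ) s        = λ v wv t → substVal⇐ σ Val ψ (s v wv (substVal⇒ σ Val φ t))
  substVal⇐ σ Val (◇ φ)   s        = λ u wu → let v , uv , t = s u wu in v , uv , substVal⇐ σ Val φ t
  substVal⇐ σ Val (□ φ)   s        = λ u v wu uv → substVal⇐ σ Val φ (s u v wu uv)

  sound : ∀ {φ} → GS4c φ → (Val : Valuation F) (w : W) → Sat F Val w φ
  sound ipc1 Val w = λ v _ s u vu _ → persistent F Val p vu s
  sound ipc2 Val w = λ v _ f u vu g a ua s →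
    f a (≼-trans vu ua) s a ≼-refl (g a ua s)
  sound ipc3 Val w = λ _ _ → proj₁
  sound ipc4 Val w = λ _ _ → proj₂
  sound ipc5 Val w = λ v _ s u vu t → persistent F Val p vu s , t
  sound ipc6 Val w = λ _ _ → inj₁
  sound ipc7 Val w = λ _ _ → inj₂
  sound ipc8 Val w = λ v _ f u vu g a ua → [ f a (≼-trans vu ua) , g a ua ]′
  sound ipc9 Val w = λ v _ b → ⊥-elim (infallible v b)
  sound K□ Val w = λ v _ f u vu g a b ua ab →
    f a b (≼-trans vu ua) ab b ≼-refl (g a b ua ab)
  sound K◇ Val w = λ v _ f u vu g a ua →
    let b , ab , s = g a ua in b , ab , f a b (≼-trans vu ua) ab b ≼-refl s
  sound T□ Val w = λ v _ f → f v v ≼-refl ⊑-refl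
  sound T◇ Val w = λ v _ s u vu → u , ⊑-refl , persistent F Val p vu s
  sound 4◇ Val w = λ v _ f u vu →
    let a , ua , g = f u vu ; b , ab , s = g a ≼-refl in b , ⊑-trans ua ab , s
  -- Back-up confluence turns `u ⊑ a ≼ b` into `u ≼ u' ⊑ b`, so the path to `c` is again one ≼
  -- followed by one ⊑.
  sound 4□ Val w = λ v _ f u a vu ua b c ab bc →
    let u' , uu' , u'b = backUp ua ab in f u' c (≼-trans vu uu') (⊑-trans u'b bc)
  sound C◇ Val w = λ v _ f → case-◇ v (f v ≼-refl)
    where
    case-◇ : ∀ v → Σ[ a ∈ W ] (v ⊑ a × (Sat F Val a p ⊎ Sat F Val a q)) →
             Sat F Val v (◇ p) ⊎ Sat F Val v (◇ q)
    case-◇ v (a , va , inj₁ s) = inj₁ (◇-intro Val p va s)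
    case-◇ v (a , va , inj₂ s) = inj₂ (◇-intro Val q va s)
  sound N◇ Val w = λ v _ f → let a , _ , b = f v ≼-refl in ⊥-elim (infallible a b)
  sound FS Val w = λ v _ f a b va ab c bc s →
    let a' , aa' , a'c = backUp ab bc in
    f a' (≼-trans va aa') (◇-intro Val p a'c s) a' c ≼-refl a'c
  sound GD Val w with lem (Sat F Val w (p ⇒ q))
  ... | yes s = inj₁ s
  -- If `v` had `q` without `p`, then by linearity every `u` above `w` with `p` would lie above `v`
  -- and have `q`, giving `p ⇒ q` at `w`.
  ... | no ¬s = inj₂ λ v wv t → decidable-stable (lem (Sat F Val v p)) λ ¬pv →
    ¬s λ u wu pu → [ (λ uv → ⊥-elim (¬pv (persistent F Val p uv pu)))
                   , (λ vu → persistent F Val q vu t) ]′ (linear wu wv)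
  sound CD Val w v wv f with lem (Sat F Val v (◇ q))
  ... | yes s = inj₂ s
  -- Forth-down confluence yields `v ⊑ v' ≼ a`; at `v'` the disjunct `q` would make `◇ q` true at
  -- `v`, so `p` holds there and persists to `a`.
  ... | no ¬s = inj₁ λ u a vu ua → let v' , vv' , v'a = forthDown vu ua in
    [ persistent F Val p v'a , (λ t → ⊥-elim (¬s (◇-intro Val q vv' t))) ]′ (f v v' ≼-refl vv')
  sound (mp d e) Val w = sound d Val w w ≼-refl (sound e Val w)
  sound (nec d) Val w = λ _ v _ _ → sound d Val v
  sound (subst {φ} σ d) Val w = substVal⇒ σ Val φ (sound d (substVal σ Val) w)

-- Completeness: the canonical model

private
  variable
    φ ψ χ : Fm
    X Y : Pred Fm 0ℓ

infix  3 _⊢_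
infixl 6 _·_

-- Necessitation applies to theorems only, so the deduction theorem holds.
data _⊢_ (X : Pred Fm 0ℓ) : Pred Fm 0ℓ where
  hyp : X φ → X ⊢ φ
  thm : GS4c φ → X ⊢ φ
  _·_ : X ⊢ φ ⇒ ψ → X ⊢ φ → X ⊢ ψ

weaken : X ⊆ Y → (X ⊢_) ⊆ (Y ⊢_)
weaken XY (hyp x) = hyp (XY x)
weaken XY (thm t) = thm t
weaken XY (d · e) = weaken XY d · weaken XY e

⊢⇒GS4c : ∅ ⊢ φ → GS4c φ
⊢⇒GS4c (hyp ())
⊢⇒GS4c (thm t) = t
⊢⇒GS4c (d · e) = mp (⊢⇒GS4c d) (⊢⇒GS4c e)

-- Turns the axioms, stated for three fixed variables, into schemes.
inst : Fm → Fm → Fm → ℕ → Fm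
inst φ ψ χ 0 = φ
inst φ ψ χ 1 = ψ
inst φ ψ χ _ = χ

⇒-const : GS4c (φ ⇒ (ψ ⇒ φ))
⇒-const {φ} {ψ} = subst (inst φ ψ φ) ipc1

⇒-distrib : GS4c ((φ ⇒ (ψ ⇒ χ)) ⇒ ((φ ⇒ ψ) ⇒ (φ ⇒ χ)))
⇒-distrib {φ} {ψ} {χ} = subst (inst φ ψ χ) ipc2

⇒-refl : GS4c (φ ⇒ φ)
⇒-refl {φ} = mp (mp (⇒-distrib {φ} {φ ⇒ φ} {φ}) ⇒-const) ⇒-const

⇒-trans : GS4c (φ ⇒ ψ) → GS4c (ψ ⇒ χ) → GS4c (φ ⇒ χ)
⇒-trans d e = mp (mp ⇒-distrib (mp ⇒-const e)) d

⋀-elimˡ : GS4c ((φ ⋀ ψ) ⇒ φ)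
⋀-elimˡ {φ} {ψ} = subst (inst φ ψ φ) ipc3

⋀-elimʳ : GS4c ((φ ⋀ ψ) ⇒ ψ)
⋀-elimʳ {φ} {ψ} = subst (inst φ ψ φ) ipc4

⋀-intro : GS4c (φ ⇒ (ψ ⇒ (φ ⋀ ψ)))
⋀-intro {φ} {ψ} = subst (inst φ ψ φ) ipc5

⋁-introˡ : GS4c (φ ⇒ (φ ⋁ ψ))
⋁-introˡ {φ} {ψ} = subst (inst φ ψ φ) ipc6

⋁-introʳ : GS4c (ψ ⇒ (φ ⋁ ψ))
⋁-introʳ {ψ} {φ} = subst (inst φ ψ φ) ipc7

⋁-elim : GS4c ((φ ⇒ χ) ⇒ ((ψ ⇒ χ) ⇒ ((φ ⋁ ψ) ⇒ χ)))
⋁-elim {φ} {χ} {ψ} = subst (inst φ ψ χ) ipc8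

⋁-mono : ∀ {φ φ' ψ ψ'} → GS4c (φ ⇒ φ') → GS4c (ψ ⇒ ψ') → GS4c ((φ ⋁ ψ) ⇒ (φ' ⋁ ψ'))
⋁-mono d e = mp (mp ⋁-elim (⇒-trans d ⋁-introˡ)) (⇒-trans e ⋁-introʳ)

□-K : GS4c (□ (φ ⇒ ψ) ⇒ (□ φ ⇒ □ ψ))
□-K {φ} {ψ} = subst (inst φ ψ φ) K□

□-mono : GS4c (φ ⇒ ψ) → GS4c (□ φ ⇒ □ ψ)
□-mono d = mp □-K (nec d)

-- Filter bases and ideal bases for the order of provable implication.
DownDirected UpDirected : Pred Fm 0ℓ → Set
DownDirected E = ∃ E × (∀ {φ ψ} → E φ → E ψ → ∃[ χ ] E χ × GS4c (χ ⇒ φ) × GS4c (χ ⇒ ψ))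
UpDirected   Y = ∃ Y × (∀ {φ ψ} → Y φ → Y ψ → ∃[ χ ] Y χ × GS4c (φ ⇒ χ) × GS4c (ψ ⇒ χ))

singleton-down : DownDirected ｛ φ ｝
singleton-down {φ} = (φ , refl) , λ { refl refl → φ , refl , ⇒-refl , ⇒-refl }

singleton-up : UpDirected ｛ φ ｝
singleton-up {φ} = (φ , refl) , λ { refl refl → φ , refl , ⇒-refl , ⇒-refl }

-- Directedness lets the finitely many premises used from E be replaced by a single one.
deduction : ∀ {E} → DownDirected E → X ∪ E ⊢ φ → ∃[ η ] E η × (X ⊢ η ⇒ φ)
deduction ((η , Eη) , _) (hyp (inj₁ x)) = η , Eη , thm ⇒-const · hyp x
deduction _ (hyp (inj₂ e)) = _ , e , thm ⇒-refl
deduction ((η , Eη) , _) (thm t) = η , Eη , thm (mp ⇒-const t)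
deduction dir@(_ , meet) (d · e) =
  let η₁ , E₁ , d' = deduction dir d
      η₂ , E₂ , e' = deduction dir e
      η , Eη , l , r = meet E₁ E₂
  in η , Eη , thm ⇒-distrib
     · (thm ⇒-distrib · (thm ⇒-const · d') · thm l)
     · (thm ⇒-distrib · (thm ⇒-const · e') · thm r)

-- Theories are Boolean-valued so that they form a small type, as worlds of a frame must.
record PrimeTheory : Set where
  field
    holds : Fm → Bool

  ⟦_⟧ : Pred Fm 0ℓ
  ⟦_⟧ φ = T (holds φ)

  field
    closed     : (⟦_⟧ ⊢_) ⊆ ⟦_⟧
    prime      : ⟦_⟧ (φ ⋁ ψ) → ⟦_⟧ φ ⊎ ⟦_⟧ ψ
    consistent : ¬ ⟦_⟧ fbot

  apply : GS4c (φ ⇒ ψ) → ⟦_⟧ φ → ⟦_⟧ ψ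
  apply d x = closed (thm d · hyp x)

  modusPonens : ⟦_⟧ (φ ⇒ ψ) → ⟦_⟧ φ → ⟦_⟧ ψ
  modusPonens x y = closed (hyp x · hyp y)

  stable : ¬ ¬ ⟦_⟧ φ → ⟦_⟧ φ
  stable = decidable-stable (T? _)

  downDirected : DownDirected ⟦_⟧
  downDirected = ((fbot ⇒ fbot) , closed (thm ⇒-refl)) ,
    λ x y → _ , closed (thm ⋀-intro · hyp x · hyp y) , ⋀-elimˡ , ⋀-elimʳ

  complement-up : UpDirected (¬_ ∘ ⟦_⟧)
  complement-up = (fbot , consistent) ,
    λ x y → _ , [ x , y ]′ ∘ prime , ⋁-introˡ , ⋁-introʳ

  -- Necessitation and the K axiom box a derivation line by line.
  □-closed : ((λ φ → ⟦_⟧ (□ φ)) ⊢_) ⊆ λ φ → ⟦_⟧ (□ φ)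
  □-closed (hyp x) = x
  □-closed (thm t) = closed (thm (nec t))
  □-closed (d · e) = modusPonens (apply □-K (□-closed d)) (□-closed e)

open PrimeTheory using (⟦_⟧; closed; prime; consistent; apply; modusPonens; stable;
  downDirected; complement-up; □-closed)

-- Enumeration of formulas and Lindenbaum's lemma

formulas : ℕ → List Fm
formulas zero    = []
formulas (suc n) =
  formulas n ++ var n ∷ fbot ∷ map ◇_ (formulas n) ++ map □_ (formulas n)
  ++ cartesianProductWith _⋀_ (formulas n) (formulas n)
  ++ cartesianProductWith _⋁_ (formulas n) (formulas n)
  ++ cartesianProductWith _⇒_ (formulas n) (formulas n)

formulas-mono : ∀ {m n} → m ≤′ n → φ ∈ formulas m → φ ∈ formulas n
formulas-mono ≤′-refl        i = i
formulas-mono (≤′-step m≤′n) i = ∈-++⁺ˡ (formulas-mono m≤′n i)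

formulas-complete : ∀ φ → ∃[ n ] φ ∈ formulas n
formulas-join : ∀ φ ψ → ∃[ n ] φ ∈ formulas n × ψ ∈ formulas n
formulas-join φ ψ =
  let m , i = formulas-complete φ ; n , j = formulas-complete ψ in
  m ⊔ n , formulas-mono (≤⇒≤′ (m≤m⊔n m n)) i , formulas-mono (≤⇒≤′ (m≤n⊔m m n)) j
formulas-complete (var x) = suc x , ∈-++⁺ʳ (formulas x) (here refl)
formulas-complete fbot    = 1 , there (here refl)
formulas-complete (φ ⋀ ψ) = let n , i , j = formulas-join φ ψ ; L = formulas n in
  suc n , ∈-++⁺ʳ L (there (there (∈-++⁺ʳ (map ◇_ L) (∈-++⁺ʳ (map □_ L)
    (∈-++⁺ˡ (∈-cartesianProductWith⁺ _⋀_ i j))))))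
formulas-complete (φ ⋁ ψ) = let n , i , j = formulas-join φ ψ ; L = formulas n in
  suc n , ∈-++⁺ʳ L (there (there (∈-++⁺ʳ (map ◇_ L) (∈-++⁺ʳ (map □_ L)
    (∈-++⁺ʳ (cartesianProductWith _⋀_ L L) (∈-++⁺ˡ (∈-cartesianProductWith⁺ _⋁_ i j)))))))
formulas-complete (φ ⇒ ψ) = let n , i , j = formulas-join φ ψ ; L = formulas n in
  suc n , ∈-++⁺ʳ L (there (there (∈-++⁺ʳ (map ◇_ L) (∈-++⁺ʳ (map □_ L)
    (∈-++⁺ʳ (cartesianProductWith _⋀_ L L) (∈-++⁺ʳ (cartesianProductWith _⋁_ L L)
      (∈-cartesianProductWith⁺ _⇒_ i j)))))))
formulas-complete (◇ φ) = let n , i = formulas-complete φ ; L = formulas n in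
  suc n , ∈-++⁺ʳ L (there (there (∈-++⁺ˡ (∈-map⁺ ◇_ i))))
formulas-complete (□ φ) = let n , i = formulas-complete φ ; L = formulas n in
  suc n , ∈-++⁺ʳ L (there (there (∈-++⁺ʳ (map ◇_ L) (∈-++⁺ˡ (∈-map⁺ □_ i)))))

Meets : Pred Fm 0ℓ → Pred Fm 0ℓ → Set
Meets Y X = ∃[ y ] Y y × (X ⊢ y)

meets-mono : ∀ {X X'} → X ⊆ X' → Meets Y X → Meets Y X'
meets-mono XX' (y , Yy , d) = y , Yy , weaken XX' d

module Lindenbaum (lem : LEM) (Y : Pred Fm 0ℓ) (Y-up : UpDirected Y) where

  -- The side condition is part of the set, so the construction makes no case distinction; excluded
  -- middle enters only in the lemmas about it.
  step : Pred Fm 0ℓ → Fm → Pred Fm 0ℓ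
  step X φ = X ∪ λ ψ → φ ≡ ψ × ¬ Meets Y (X ∪ ｛ φ ｝)

  step-avoids : ¬ Meets Y X → ¬ Meets Y (step X φ)
  step-avoids {X} {φ} av m with lem (Meets Y (X ∪ ｛ φ ｝))
  ... | yes m' = av (meets-mono [ id , (λ (_ , av') → ⊥-elim (av' m')) ]′ m)
  ... | no av' = av' (meets-mono [ inj₁ , inj₂ ∘ proj₁ ]′ m)

  run : Pred Fm 0ℓ → List Fm → Pred Fm 0ℓ
  run = foldl step

  run-extends : ∀ l → X ⊆ run X l
  run-extends []      = id
  run-extends (φ ∷ l) = run-extends l ∘ inj₁

  run-avoids : ∀ l → ¬ Meets Y X → ¬ Meets Y (run X l)
  run-avoids []      av = av
  run-avoids (φ ∷ l) av = run-avoids l (step-avoids av)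

  run-decides : ∀ l → φ ∈ l → run X l φ ⊎ Meets Y (run X l ∪ ｛ φ ｝)
  run-decides {φ} {X} (φ ∷ l) (here refl) with lem (Meets Y (X ∪ ｛ φ ｝))
  ... | yes m = inj₂ (meets-mono [ inj₁ ∘ run-extends (φ ∷ l) , inj₂ ]′ m)
  ... | no av = inj₁ (run-extends l (inj₂ (refl , av)))
  run-decides (_ ∷ l) (there i) = run-decides l i

  stage : Pred Fm 0ℓ → ℕ → Pred Fm 0ℓ
  stage X zero    = X
  stage X (suc n) = run (stage X n) (formulas n)

  stage-mono : ∀ {m n} → m ≤′ n → stage X m ⊆ stage X n
  stage-mono ≤′-refl        = id
  stage-mono {n = suc n} (≤′-step m≤′n) = run-extends (formulas n) ∘ stage-mono m≤′n

  stage-avoids : ¬ Meets Y X → ∀ n → ¬ Meets Y (stage X n)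
  stage-avoids av zero    = av
  stage-avoids av (suc n) = run-avoids (formulas n) (stage-avoids av n)

  limit : Pred Fm 0ℓ → Pred Fm 0ℓ
  limit X φ = ∃[ n ] stage X n φ

  limit-compact : limit X ⊢ φ → ∃[ n ] (stage X n ⊢ φ)
  limit-compact (hyp (n , x)) = n , hyp x
  limit-compact (thm t) = 0 , thm t
  limit-compact (d · e) =
    let m , d' = limit-compact d ; n , e' = limit-compact e in
    m ⊔ n , weaken (stage-mono (≤⇒≤′ (m≤m⊔n m n))) d' · weaken (stage-mono (≤⇒≤′ (m≤n⊔m m n))) e'

  limit-avoids : ¬ Meets Y X → ¬ Meets Y (limit X)
  limit-avoids av (y , Yy , d) = let n , d' = limit-compact d in stage-avoids av n (y , Yy , d')

  -- By the deduction theorem, a formula that was refused implies a member of `Y`; primeness rests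
  -- on this.
  limit-decides : ∀ X φ → limit X φ ⊎ (∃[ y ] Y y × (limit X ⊢ φ ⇒ y))
  limit-decides X φ with formulas-complete φ
  ... | n , i with run-decides {X = stage X n} (formulas n) i
  ... | inj₁ x = inj₁ (suc n , x)
  ... | inj₂ (y , Yy , d) with deduction singleton-down d
  ... | .φ , refl , d' = inj₂ (y , Yy , weaken (λ x → suc n , x) d')

  extend : ¬ Meets Y X → Σ[ Δ ∈ PrimeTheory ] X ⊆ ⟦ Δ ⟧ × (∀ {y} → Y y → ¬ ⟦ Δ ⟧ y)
  extend {X} av = Δ , (λ x → fromWitness (hyp (0 , x))) , λ Yy x → av' (_ , Yy , toWitness x)
    where
    av' = limit-avoids av

    -- The theory is the deductive closure of the limit, and closing twice adds nothing.
    flatten : ∀ {φ} → (λ φ → T ⌊ lem (limit X ⊢ φ) ⌋) ⊢ φ → limit X ⊢ φ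
    flatten (hyp x) = toWitness x
    flatten (thm t) = thm t
    flatten (d · e) = flatten d · flatten e

    split : ∀ φ ψ → limit X ⊢ φ ⋁ ψ → limit X φ ⊎ limit X ψ
    split φ ψ d with limit-decides X φ | limit-decides X ψ
    ... | inj₁ x | _      = inj₁ x
    ... | _      | inj₁ x = inj₂ x
    ... | inj₂ (_ , Y₁ , d₁) | inj₂ (_ , Y₂ , d₂) =
      -- If both disjuncts were refused, the disjunction would imply a common upper bound in `Y`,
      -- which the limit avoids.
      let y , Yy , l , r = proj₂ Y-up Y₁ Y₂
          raise = λ {χ} {y'} (e : limit X ⊢ χ ⇒ y') (t : GS4c (y' ⇒ y)) →
                    thm ⇒-distrib · (thm (mp ⇒-const t)) · e
      in ⊥-elim (av' (y , Yy , thm ⋁-elim · raise d₁ l · raise d₂ r · d))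

    Δ : PrimeTheory
    Δ = record
      { holds      = λ φ → ⌊ lem (limit X ⊢ φ) ⌋
      ; closed     = fromWitness ∘ flatten
      ; prime      = λ x → [ inj₁ ∘ fromWitness ∘ hyp , inj₂ ∘ fromWitness ∘ hyp ]′ (split _ _ (toWitness x))
      ; consistent = λ x → let (y , Yy) , _ = Y-up in
                       av' (y , Yy , thm (subst (inst y y y) ipc9) · toWitness x)
      }

module Canonical (lem : LEM) where

  _≤ₜ_ _⊴_ : PrimeTheory → PrimeTheory → Set
  Γ ≤ₜ Δ = ∀ φ → ⟦ Γ ⟧ φ → ⟦ Δ ⟧ φ
  Γ ⊴ Δ  = (∀ φ → ⟦ Γ ⟧ (□ φ) → ⟦ Δ ⟧ φ) × (∀ φ → ⟦ Δ ⟧ φ → ⟦ Γ ⟧ (◇ φ))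

  avoid : UpDirected Y → ¬ Meets Y X →
          Σ[ Δ ∈ PrimeTheory ] X ⊆ ⟦ Δ ⟧ × (∀ {y} → Y y → ¬ ⟦ Δ ⟧ y)
  avoid {Y} Y-up = Lindenbaum.extend lem Y Y-up

  module _ (Γ : PrimeTheory) where

    ◇-join : ¬ ⟦ Γ ⟧ (◇ φ) → ¬ ⟦ Γ ⟧ (◇ ψ) → ¬ ⟦ Γ ⟧ (◇ (φ ⋁ ψ))
    ◇-join {φ} {ψ} x y = [ x , y ]′ ∘ prime Γ ∘ apply Γ (subst (inst φ ψ φ) C◇)

    ◇-fbot : ¬ ⟦ Γ ⟧ (◇ fbot)
    ◇-fbot = consistent Γ ∘ apply Γ N◇

    -- `Δ` must avoid `Y` and also every `θ` with `◇ θ` outside `Γ`; avoiding all `y ⋁ θ` does both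
    -- at once. If `□⁻¹Γ` derived such a disjunction, `CD` would put `□ y` or `◇ θ` into `Γ`.
    □-witness : UpDirected Y → (∀ {φ} → Y φ → ¬ ⟦ Γ ⟧ (□ φ)) →
                Σ[ Δ ∈ PrimeTheory ] Γ ⊴ Δ × (∀ {φ} → Y φ → ¬ ⟦ Δ ⟧ φ)
    □-witness {Y} ((y₀ , Yy₀) , join) ¬□Y =
      let Δ , □Γ⊆Δ , av = avoid Z-up avoids in
      Δ , ((λ _ → □Γ⊆Δ)
          , λ φ x → stable Γ λ ¬◇φ → av (y₀ , φ , Yy₀ , ¬◇φ , refl) (apply Δ ⋁-introʳ x))
        , λ {y} Yy x → av (y , fbot , Yy , ◇-fbot , refl) (apply Δ ⋁-introˡ x)
      where
      Z : Pred Fm 0ℓ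
      Z χ = ∃[ y ] ∃[ θ ] Y y × (¬ ⟦ Γ ⟧ (◇ θ)) × χ ≡ (y ⋁ θ)

      Z-up : UpDirected Z
      Z-up = (_ , y₀ , fbot , Yy₀ , ◇-fbot , refl) , λ
        { (_ , _ , Y₁ , n₁ , refl) (_ , _ , Y₂ , n₂ , refl) →
          let y , Yy , l , r = join Y₁ Y₂ in
          _ , (y , _ , Yy , ◇-join n₁ n₂ , refl) , ⋁-mono l ⋁-introˡ , ⋁-mono r ⋁-introʳ }

      avoids : ¬ Meets Z (λ φ → ⟦ Γ ⟧ (□ φ))
      avoids (_ , (y , θ , Yy , n , refl) , d) =
        [ ¬□Y Yy , n ]′ (prime Γ (apply Γ (subst (inst y θ y) CD) (□-closed Γ d)))

    -- `□⁻¹Γ ∪ E` is extended while avoiding the complement of `◇⁻¹Γ`, an ideal base by `C◇` and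
    -- `N◇`. A derivation of some `y` in it would give `□ (η ⇒ y)` in `Γ` for some `η` in `E`, hence
    -- `◇ y` by `K◇`.
    ◇-witness : ∀ {E} → DownDirected E → (∀ {φ} → E φ → ⟦ Γ ⟧ (◇ φ)) →
                Σ[ Δ ∈ PrimeTheory ] Γ ⊴ Δ × E ⊆ ⟦ Δ ⟧
    ◇-witness {E} E-down ◇E =
      let Δ , ⊆Δ , av = avoid up avoids in
      Δ , ((λ _ → ⊆Δ ∘ inj₁) , λ _ x → stable Γ λ ¬◇φ → av ¬◇φ x) , ⊆Δ ∘ inj₂
      where
      up : UpDirected (λ φ → ¬ ⟦ Γ ⟧ (◇ φ))
      up = (fbot , ◇-fbot) , λ n₁ n₂ → _ , ◇-join n₁ n₂ , ⋁-introˡ , ⋁-introʳ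

      avoids : ¬ Meets (λ φ → ¬ ⟦ Γ ⟧ (◇ φ)) ((λ φ → ⟦ Γ ⟧ (□ φ)) ∪ E)
      avoids (y , n , d) =
        let η , Eη , d' = deduction E-down d in
        n (modusPonens Γ (apply Γ (subst (inst η y y) K◇) (□-closed Γ d')) (◇E Eη))

  ⊴-refl : ∀ {Γ} → Γ ⊴ Γ
  ⊴-refl {Γ} = (λ φ → apply Γ (subst (inst φ φ φ) T□)) , λ φ → apply Γ (subst (inst φ φ φ) T◇)

  ⊴-trans : ∀ {Γ Δ Θ} → Γ ⊴ Δ → Δ ⊴ Θ → Γ ⊴ Θ
  ⊴-trans {Γ} (b₁ , d₁) (b₂ , d₂) =
    (λ φ → b₂ φ ∘ b₁ (□ φ) ∘ apply Γ (subst (inst φ φ φ) 4□)) ,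
    (λ φ → apply Γ (subst (inst φ φ φ) 4◇) ∘ d₁ (◇ φ) ∘ d₂ φ)

  frame : Frame PrimeTheory
  frame = record
    { W⊥ = λ _ → ⊥ ; _≼_ = _≤ₜ_ ; _⊑_ = _⊴_
    ; ≼-refl = λ _ → id ; ≼-trans = λ a b φ → b φ ∘ a φ
    ; ⊑-refl = λ {Γ} → ⊴-refl {Γ} ; ⊑-trans = λ {Γ} {Δ} {Θ} → ⊴-trans {Γ} {Δ} {Θ}
    ; W⊥-≼ = λ _ () ; W⊥-⊑ = λ _ () }

  forthUp : ForthUp frame
  forthUp {Γ} {Γ'} {Δ} Γ≤Γ' (_ , d) =
    let Δ' , Γ'⊴Δ' , Δ⊆Δ' = ◇-witness Γ' (downDirected Δ) (λ {φ} x → Γ≤Γ' (◇ φ) (d φ x)) in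
    Δ' , (λ _ → Δ⊆Δ') , Γ'⊴Δ'

  -- A theory that avoids the complement of `Δ'` is contained in `Δ'`, so the whole complement is
  -- what the □-witness has to avoid.
  forthDown : ForthDown frame
  forthDown {Γ} {Γ'} {Δ'} Γ≤Γ' (b , _) =
    let Δ , Γ⊴Δ , av = □-witness Γ (complement-up Δ') (λ n x → n (b _ (Γ≤Γ' _ x))) in
    Δ , Γ⊴Δ , λ φ x → stable Δ' λ n → av n x

  -- `Γ'` extends `Γ` by all `◇ δ` with `δ` in `Δ'` and avoids all `□ θ` with `θ` outside it.
  -- Failure would put `◇ δ ⇒ □ θ` into `Γ`; by `FS`, `δ ⇒ θ` would then lie in `Δ`, hence in `Δ'`,
  -- and so would `θ`.
  backUp : BackUp frame
  backUp {Γ} {Δ} {Δ'} (b , _) Δ≤Δ' =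
    let Γ' , ⊆Γ' , av = avoid up avoids in
    Γ' , (λ _ → ⊆Γ' ∘ inj₁) ,
    (λ φ x → stable Δ' λ n → av (φ , n , refl) x) , λ φ x → ⊆Γ' (inj₂ (φ , x , refl))
    where
    ◇Δ' □∁Δ' : Pred Fm 0ℓ
    ◇Δ' χ = ∃[ δ ] ⟦ Δ' ⟧ δ × χ ≡ (◇ δ)
    □∁Δ' χ = ∃[ θ ] (¬ ⟦ Δ' ⟧ θ) × χ ≡ (□ θ)

    ◇-mono : GS4c (φ ⇒ ψ) → GS4c (◇ φ ⇒ ◇ ψ)
    ◇-mono {φ} {ψ} d = mp (subst (inst φ ψ φ) K◇) (nec d)

    down : DownDirected ◇Δ'
    down = let (δ , x) , meet = downDirected Δ' in (_ , δ , x , refl) , λ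
      { (_ , x₁ , refl) (_ , x₂ , refl) → let δ , x , l , r = meet x₁ x₂ in
        _ , (δ , x , refl) , ◇-mono l , ◇-mono r }

    up : UpDirected □∁Δ'
    up = let (θ , n) , join = complement-up Δ' in (_ , θ , n , refl) , λ
      { (_ , n₁ , refl) (_ , n₂ , refl) → let θ , n , l , r = join n₁ n₂ in
        _ , (θ , n , refl) , □-mono l , □-mono r }

    avoids : ¬ Meets □∁Δ' (⟦ Γ ⟧ ∪ ◇Δ')
    avoids (_ , (θ , n , refl) , d) with deduction down d
    ... | _ , (δ , x , refl) , d' =
      n (modusPonens Δ' (Δ≤Δ' _ (b _ (apply Γ (subst (inst δ θ δ) FS) (closed Γ d')))) x)

  linear : UpwardLinear frame
  linear {Γ} {Δ} {Θ} Γ≤Δ Γ≤Θ with lem (Δ ≤ₜ Θ)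
  ... | yes l = inj₁ l
  ... | no ¬l = inj₂ λ ψ y → stable Δ λ n → ¬l λ φ x →
    [ (λ φ⇒ψ → ⊥-elim (n (modusPonens Δ (Γ≤Δ _ φ⇒ψ) x))) , (λ ψ⇒φ → modusPonens Θ (Γ≤Θ _ ψ⇒φ) y) ]′
      (prime Γ (closed Γ (thm (subst (inst φ ψ φ) GD))))

  isGS4c : IsGS4cFrame frame
  isGS4c =
    (λ _ ()) ,
    (λ {Γ} {Δ} {Θ} → forthUp {Γ} {Δ} {Θ}) , (λ {Γ} {Δ} {Θ} → backUp {Γ} {Δ} {Θ}) ,
    (λ {Γ} {Δ} {Θ} → forthDown {Γ} {Δ} {Θ}) , (λ {Γ} {Δ} {Θ} → linear {Γ} {Δ} {Θ})

  valuation : Valuation frame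
  valuation = record { V = λ x Γ → ⟦ Γ ⟧ (var x) ; V-mono = λ l → l _ ; V-⊥ = λ () }

  -- The two directions are mutual because implication swaps them at its antecedent.
  truth⇐ : ∀ φ Γ → ⟦ Γ ⟧ φ → Sat frame valuation Γ φ
  truth⇒ : ∀ φ Γ → Sat frame valuation Γ φ → ⟦ Γ ⟧ φ
  truth⇐ (var x) Γ m = m
  truth⇐ fbot    Γ m = consistent Γ m
  truth⇐ (φ ⋀ ψ) Γ m = truth⇐ φ Γ (apply Γ ⋀-elimˡ m) , truth⇐ ψ Γ (apply Γ ⋀-elimʳ m)
  truth⇐ (φ ⋁ ψ) Γ m = [ inj₁ ∘ truth⇐ φ Γ , inj₂ ∘ truth⇐ ψ Γ ]′ (prime Γ m)
  truth⇐ (φ ⇒ ψ) Γ m = λ Δ Γ≤Δ s → truth⇐ ψ Δ (modusPonens Δ (Γ≤Δ _ m) (truth⇒ φ Δ s))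
  truth⇐ (◇ φ)   Γ m = λ Γ' Γ≤Γ' →
    let Δ , Γ'⊴Δ , φ∈Δ = ◇-witness Γ' singleton-down (λ { refl → Γ≤Γ' _ m }) in
    Δ , Γ'⊴Δ , truth⇐ φ Δ (φ∈Δ refl)
  truth⇐ (□ φ)   Γ m = λ Γ' Δ Γ≤Γ' Γ'⊴Δ → truth⇐ φ Δ (proj₁ Γ'⊴Δ φ (Γ≤Γ' _ m))
  truth⇒ (var x) Γ s        = s
  truth⇒ (φ ⋀ ψ) Γ (s , t)  = closed Γ (thm ⋀-intro · hyp (truth⇒ φ Γ s) · hyp (truth⇒ ψ Γ t))
  truth⇒ (φ ⋁ ψ) Γ (inj₁ s) = apply Γ ⋁-introˡ (truth⇒ φ Γ s)
  truth⇒ (φ ⋁ ψ) Γ (inj₂ s) = apply Γ ⋁-introʳ (truth⇒ ψ Γ s)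
  truth⇒ (φ ⇒ ψ) Γ s = stable Γ λ n →
    let Δ , ⊆Δ , av = avoid singleton-up (avoids n) in
    av refl (truth⇒ ψ Δ (s Δ (λ _ → ⊆Δ ∘ inj₁) (truth⇐ φ Δ (⊆Δ (inj₂ refl)))))
    where
    avoids : ¬ ⟦ Γ ⟧ (φ ⇒ ψ) → ¬ Meets ｛ ψ ｝ (⟦ Γ ⟧ ∪ ｛ φ ｝)
    avoids n (_ , refl , d) with deduction singleton-down d
    ... | _ , refl , d' = n (closed Γ d')
  truth⇒ (◇ φ)   Γ s = let Δ , Γ⊴Δ , t = s Γ (λ _ → id) in proj₂ Γ⊴Δ φ (truth⇒ φ Δ t)
  truth⇒ (□ φ)   Γ s = stable Γ λ n →
    let Δ , Γ⊴Δ , av = □-witness Γ singleton-up (λ { refl → n }) in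
    av refl (truth⇒ φ Δ (s Γ Δ (λ _ → id) Γ⊴Δ))

  falsifiable : ¬ GS4c φ → Falsifiable frame φ
  falsifiable {φ} n =
    let Γ , _ , av = avoid singleton-up λ { (_ , refl , d) → n (⊢⇒GS4c d) } in
    valuation , Γ , id , av refl ∘ truth⇒ φ Γ

-- Subformulas and occurring variables

sf : Fm → List Fm
sf (var x) = var x ∷ []
sf fbot    = fbot ∷ []
sf (φ ⋀ ψ) = (φ ⋀ ψ) ∷ sf φ ++ sf ψ
sf (φ ⋁ ψ) = (φ ⋁ ψ) ∷ sf φ ++ sf ψ
sf (φ ⇒ ψ) = (φ ⇒ ψ) ∷ sf φ ++ sf ψ
sf (◇ φ)   = (◇ φ) ∷ sf φ
sf (□ φ)   = (□ φ) ∷ sf φ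

sf-refl : ∀ φ → φ ∈ sf φ
sf-refl (var x) = here refl
sf-refl fbot    = here refl
sf-refl (φ ⋀ ψ) = here refl
sf-refl (φ ⋁ ψ) = here refl
sf-refl (φ ⇒ ψ) = here refl
sf-refl (◇ φ)   = here refl
sf-refl (□ φ)   = here refl

varBound : Fm → ℕ
varBound (var x) = suc x
varBound fbot    = 0
varBound (φ ⋀ ψ) = varBound φ + varBound ψ
varBound (φ ⋁ ψ) = varBound φ + varBound ψ
varBound (φ ⇒ ψ) = varBound φ + varBound ψ
varBound (◇ φ)   = varBound φ
varBound (□ φ)   = varBound φ

var<varBound : ∀ {x} φ → var x ∈ sf φ → x < varBound φ
var<varBound-++ : ∀ {x} φ ψ → var x ∈ sf φ ++ sf ψ → x < varBound φ + varBound ψ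
var<varBound (var x) (here refl) = ≤-refl
var<varBound fbot    (here ())
var<varBound (φ ⋀ ψ) (there i) = var<varBound-++ φ ψ i
var<varBound (φ ⋁ ψ) (there i) = var<varBound-++ φ ψ i
var<varBound (φ ⇒ ψ) (there i) = var<varBound-++ φ ψ i
var<varBound (◇ φ)   (there i) = var<varBound φ i
var<varBound (□ φ)   (there i) = var<varBound φ i
var<varBound-++ φ ψ i with ∈-++⁻ (sf φ) i
... | inj₁ j = ≤-trans (var<varBound φ j) (m≤m+n _ _)
... | inj₂ j = ≤-trans (var<varBound ψ j) (m≤n+m _ _)

-- Filtration through cones

module Filtration {W : Set} (F : Frame W) (isG : IsGS4cFrame F) (Val : Valuation F) (Φ : List Fm) where
  open Frame F
  open GS4cFrame F isG

  _⊨_ : W → Fm → Set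
  w ⊨ φ = Sat F Val w φ

  infix 4 _≲_ _~_ _≈_ _≅_ _≼ᶠ_ _⊑ᶠ_

  _≲_ _~_ _≈_ : W → W → Set
  u ≲ v = ∀ ψ → ψ ∈ Φ → u ⊨ ψ → v ⊨ ψ
  u ~ v = u ≲ v × v ≲ u

  -- Thus `x ≈ y` says that the ≼-cones of `x` and `y` realise the same set of Φ-types.
  Covers : W → W → Set
  Covers x y = ∀ {u} → x ≼ u → ∃[ v ] (y ≼ v × u ~ v)

  x ≈ y = Covers x y × Covers y x

  ≲-refl : ∀ {u} → u ≲ u
  ≲-refl _ _ = id

  ≲-trans : ∀ {u v w} → u ≲ v → v ≲ w → u ≲ w
  ≲-trans l m ψ i = m ψ i ∘ l ψ i

  ~-refl : ∀ {u} → u ~ u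
  ~-refl = ≲-refl , ≲-refl

  ~-sym : ∀ {u v} → u ~ v → v ~ u
  ~-sym (l , r) = r , l

  ~-trans : ∀ {u v w} → u ~ v → v ~ w → u ~ w
  ~-trans (l , r) (l' , r') = ≲-trans l l' , ≲-trans r' r

  ≼⇒≲ : ∀ {u v} → u ≼ v → u ≲ v
  ≼⇒≲ uv ψ _ = persistent F Val ψ uv

  covers-trans : ∀ {x y z} → Covers x y → Covers y z → Covers x z
  covers-trans c d xu =
    let v , yv , uv = c xu ; w , zw , vw = d yv in w , zw , ~-trans uv vw

  ≈-refl : ∀ {x} → x ≈ x
  ≈-refl = (λ xu → _ , xu , ~-refl) , λ xu → _ , xu , ~-refl

  ≈-sym : ∀ {x y} → x ≈ y → y ≈ x
  ≈-sym (c , d) = d , c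

  ≈-trans : ∀ {x y z} → x ≈ y → y ≈ z → x ≈ z
  ≈-trans (c , d) (c' , d') = covers-trans c c' , covers-trans d' d

  -- A world of the filtration remembers the ≼-cone it is viewed in: this makes its
  -- ≼-predecessors part of the data, which forth–down confluence needs.
  record Point : Set where
    constructor point
    field
      {root world} : W
      root≼world   : root ≼ world
  open Point

  record _≅_ (a b : Point) : Set where
    constructor mk≅
    field
      root≈  : root a ≈ root b
      world~ : world a ~ world b
  open _≅_

  -- The order never leaves a class of cones. A cone is a chain by upward linearity, so points with
  -- equivalent roots are comparable.
  record _≼ᶠ_ (a b : Point) : Set where
    constructor mk≼ᶠ
    field
      root≈  : root a ≈ root b
      world≲ : world a ≲ world b

  ≅-refl : ∀ {a} → a ≅ a
  ≅-refl = mk≅ ≈-refl ~-refl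

  ≅-sym : ∀ {a b} → a ≅ b → b ≅ a
  ≅-sym (mk≅ c l) = mk≅ (≈-sym c) (~-sym l)

  ≅-trans : ∀ {a b c} → a ≅ b → b ≅ c → a ≅ c
  ≅-trans (mk≅ c l) (mk≅ c' l') = mk≅ (≈-trans c c') (~-trans l l')

  ≅⇒≼ᶠ : ∀ {a b} → a ≅ b → a ≼ᶠ b
  ≅⇒≼ᶠ (mk≅ c (l , _)) = mk≼ᶠ c l

  ≼ᶠ-trans : ∀ {a b c} → a ≼ᶠ b → b ≼ᶠ c → a ≼ᶠ c
  ≼ᶠ-trans (mk≼ᶠ c l) (mk≼ᶠ c' l') = mk≼ᶠ (≈-trans c c') (≲-trans l l')

  -- The last two fields weaken world source ⊑ world target: they still bound the □- and
  -- ◇-formulas, and unlike ⊑ they admit lowering the source to any world above its root.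
  record Step (a b : Point) : Set where
    field
      {source target} : Point
      a≅source : a ≅ source
      b≅target : b ≅ target
      roots    : root source ⊑ root target
      above    : ∃[ v ] (world target ≼ v × world source ⊑ v)
      below    : ∃[ u ] (world source ≼ u × u ⊑ world target)
  open Step

  _⊑ᶠ_ : Point → Point → Set
  _⊑ᶠ_ = Star Step

  ⊑⇒Step : ∀ {x u y v} (xu : x ≼ u) (yv : y ≼ v) → x ⊑ y → u ⊑ v → Step (point xu) (point yv)
  ⊑⇒Step xu yv xy uv = record
    { a≅source = ≅-refl ; b≅target = ≅-refl ; roots = xy
    ; above = _ , ≼-refl , uv ; below = _ , ≼-refl , uv }

  -- Identified points must see each other, since a code is decoded only up to `≅`.
  ≅⇒Step : ∀ {a b} → a ≅ b → Step a b
  ≅⇒Step a≅b = record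
    { a≅source = a≅b ; b≅target = ≅-refl ; roots = ⊑-refl
    ; above = _ , ≼-refl , ⊑-refl ; below = _ , ≼-refl , ⊑-refl }

  Step-respˡ : ∀ {a a' b} → a' ≅ a → Step a b → Step a' b
  Step-respˡ e s = record
    { a≅source = ≅-trans e (a≅source s) ; b≅target = b≅target s
    ; roots = roots s ; above = above s ; below = below s }

  Step-respʳ : ∀ {a b b'} → b' ≅ b → Step a b → Step a b'
  Step-respʳ e s = record
    { a≅source = a≅source s ; b≅target = ≅-trans e (b≅target s)
    ; roots = roots s ; above = above s ; below = below s }

  -- Some `u` in the cone of `a'` has the type of `b`. If it lies below `world a'`, the types are
  -- squeezed together and `world a'` itself represents `b`.
  lift-up : ∀ {a a' b} → a ≅ a' → a ≼ᶠ b →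
            ∃[ u ] Σ[ ru ∈ root a' ≼ u ] world a' ≼ u × b ≅ point ru
  lift-up {a' = a'} {b} (mk≅ c (_ , a'≲a)) (mk≼ᶠ d a≲b) =
    let e = ≈-trans (≈-sym d) c
        u , ru , b~u = proj₁ e (root≼world b)
    in [ (λ a'≼u → u , ru , a'≼u , mk≅ e b~u)
       , (λ u≼a' → world a' , root≼world a' , ≼-refl
                   , mk≅ e (≲-trans (proj₁ b~u) (≼⇒≲ u≼a') , ≲-trans a'≲a a≲b))
       ]′ (linear (root≼world a') ru)

  lift-down : ∀ {a a' b} → a ≅ a' → b ≼ᶠ a →
              ∃[ u ] Σ[ ru ∈ root a' ≼ u ] u ≼ world a' × b ≅ point ru
  lift-down {a' = a'} {b} (mk≅ c (a≲a' , _)) (mk≼ᶠ d b≲a) =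
    let e = ≈-trans d c
        u , ru , b~u = proj₁ e (root≼world b)
    in [ (λ u≼a' → u , ru , u≼a' , mk≅ e b~u)
       , (λ a'≼u → world a' , root≼world a' , ≼-refl
                   , mk≅ e (≲-trans b≲a a≲a' , ≲-trans (≼⇒≲ a'≼u) (proj₂ b~u)))
       ]′ (linear ru (root≼world a'))

  Step-forthUp : ∀ {a a' b} → a ≼ᶠ a' → Step a b → ∃[ b' ] b ≼ᶠ b' × Step a' b'
  Step-forthUp a≼a' s =
    let u , ru , s≼u , a'≅u = lift-up (a≅source s) a≼a'
        v , t≼v , s⊑v = above s
        w , v≼w , u⊑w = forthUp s≼u s⊑v
        rw = ≼-trans (root≼world (target s)) (≼-trans t≼v v≼w)
    in point rw
     , ≼ᶠ-trans (≅⇒≼ᶠ (b≅target s)) (mk≼ᶠ ≈-refl (≼⇒≲ (≼-trans t≼v v≼w)))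
     , Step-respˡ a'≅u (⊑⇒Step ru rw (roots s) u⊑w)

  Step-backUp : ∀ {a b b'} → Step a b → b ≼ᶠ b' → ∃[ a' ] a ≼ᶠ a' × Step a' b'
  Step-backUp s b≼b' =
    let v , rv , t≼v , b'≅v = lift-up (b≅target s) b≼b'
        u , s≼u , u⊑t = below s
        w , u≼w , w⊑v = backUp u⊑t t≼v
        rw = ≼-trans (root≼world (source s)) (≼-trans s≼u u≼w)
    in point rw
     , ≼ᶠ-trans (≅⇒≼ᶠ (a≅source s)) (mk≼ᶠ ≈-refl (≼⇒≲ (≼-trans s≼u u≼w)))
     , Step-respʳ b'≅v (⊑⇒Step rw rv (roots s) w⊑v)

  -- Forth-down confluence of `F` could lead outside the cone of the target. Instead `u` is matched
  -- by forth-up confluence from the roots, and the match `v` is compared with the target inside its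
  -- cone.
  Step-forthDown : ∀ {a a' b} → a' ≼ᶠ a → Step a b → ∃[ b' ] Step a' b' × b' ≼ᶠ b
  Step-forthDown a'≼a s =
    let u , ru , u≼s , a'≅u = lift-down (a≅source s) a'≼a
        w , s≼w , w⊑t = below s
        v , rv , u⊑v = forthUp ru (roots s)
    -- If `v` lies above the target, `b` itself is the successor: `v` witnesses `above`, and the old
    -- `below` still applies to the lowered source.
    in [ (λ t≼v → _
           , record { a≅source = a'≅u ; b≅target = b≅target s ; roots = roots s
                    ; above = v , t≼v , u⊑v ; below = w , ≼-trans u≼s s≼w , w⊑t }
           , mk≼ᶠ ≈-refl ≲-refl)
       , (λ v≼t → point rv , Step-respˡ a'≅u (⊑⇒Step ru rv (roots s) u⊑v)
           , ≼ᶠ-trans (mk≼ᶠ ≈-refl (≼⇒≲ v≼t)) (≅⇒≼ᶠ (≅-sym (b≅target s))))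
       ]′ (linear (root≼world (target s)) rv)

  frameᶠ : Frame Point
  frameᶠ = record
    { W⊥ = λ _ → ⊥ ; _≼_ = _≼ᶠ_ ; _⊑_ = _⊑ᶠ_
    ; ≼-refl = mk≼ᶠ ≈-refl ≲-refl ; ≼-trans = ≼ᶠ-trans
    ; ⊑-refl = ε ; ⊑-trans = _◅◅_
    ; W⊥-≼ = λ _ () ; W⊥-⊑ = λ _ () }

  forthUpᶠ : ForthUp frameᶠ
  forthUpᶠ l ε = _ , l , ε
  forthUpᶠ l (s ◅ ss) =
    let _ , l' , s'  = Step-forthUp l s
        _ , l'' , ss' = forthUpᶠ l' ss
    in _ , l'' , s' ◅ ss'

  backUpᶠ : BackUp frameᶠ
  backUpᶠ ε l = _ , l , ε
  backUpᶠ (s ◅ ss) l =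
    let _ , l' , ss' = backUpᶠ ss l
        _ , l'' , s' = Step-backUp s l'
    in _ , l'' , s' ◅ ss'

  forthDownᶠ : ForthDown frameᶠ
  forthDownᶠ l ε = _ , ε , l
  forthDownᶠ l (s ◅ ss) =
    let _ , s' , l'  = Step-forthDown l s
        _ , ss' , l'' = forthDownᶠ l' ss
    in _ , s' ◅ ss' , l''

  linearᶠ : UpwardLinear frameᶠ
  linearᶠ {_} {a} {b} (mk≼ᶠ c _) (mk≼ᶠ d _) =
    let e = ≈-trans (≈-sym d) c
        u , ru , b~u = proj₁ e (root≼world b)
    in [ (λ a≼u → inj₁ (mk≼ᶠ (≈-sym e) (≲-trans (≼⇒≲ a≼u) (proj₂ b~u))))
       , (λ u≼a → inj₂ (mk≼ᶠ e (≲-trans (proj₁ b~u) (≼⇒≲ u≼a))))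
       ]′ (linear (root≼world a) ru)

  valuationᶠ : Valuation frameᶠ
  valuationᶠ = record
    -- Membership in `Φ` is required because `≲` preserves only formulas of `Φ`.
    { V      = λ x a → var x ∈ Φ × Valuation.V Val x (world a)
    ; V-mono = λ { (mk≼ᶠ _ l) (i , m) → i , l _ i m }
    ; V-⊥    = λ () }

  -- The box persists to the `below` witness `u`; back-up confluence makes every ≼-then-⊑ path from
  -- the target one from `u`. For ◇, `above` and forth-up confluence play these parts.
  □-forward : ∀ {a b} ψ → (□ ψ) ∈ Φ → a ⊑ᶠ b → world a ⊨ (□ ψ) → world b ⊨ (□ ψ)
  □-forward ψ i ε m = m
  □-forward ψ i (s ◅ ss) m =
    let u , s≼u , u⊑t = below s
        mu = persistent F Val (□ ψ) s≼u (proj₁ (world~ (a≅source s)) _ i m)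
    in □-forward ψ i ss (proj₂ (world~ (b≅target s)) _ i λ v w t≼v v⊑w →
         let u' , u≼u' , u'⊑v = backUp u⊑t t≼v in mu u' w u≼u' (⊑-trans u'⊑v v⊑w))

  ◇-backward : ∀ {a b} ψ → (◇ ψ) ∈ Φ → a ⊑ᶠ b → world b ⊨ (◇ ψ) → world a ⊨ (◇ ψ)
  ◇-backward ψ i ε m = m
  ◇-backward ψ i (s ◅ ss) m =
    let v , t≼v , s⊑v = above s
        mv = persistent F Val (◇ ψ) t≼v (proj₁ (world~ (b≅target s)) _ i (◇-backward ψ i ss m))
    in proj₂ (world~ (a≅source s)) _ i λ u s≼u →
         let v' , v≼v' , u⊑v' = forthUp s≼u s⊑v
             w , v'⊑w , n = mv v' v≼v'
         in w , ⊑-trans u⊑v' v'⊑w , n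

  truth : ∀ φ → (∀ {ψ} → ψ ∈ sf φ → ψ ∈ Φ) → ∀ a → Sat frameᶠ valuationᶠ a φ ⇔ world a ⊨ φ
  truth (var x) i a = mk⇔ proj₂ (i (here refl) ,_)
  truth fbot    i a = mk⇔ (λ ()) (infallible _)
  truth (φ ⋀ ψ) i a =
    mk⇔ (λ (s , t) → to (ihφ a) s , to (ihψ a) t) (λ (s , t) → from (ihφ a) s , from (ihψ a) t)
    where
    ihφ = truth φ (i ∘ there ∘ ∈-++⁺ˡ)
    ihψ = truth ψ (i ∘ there ∘ ∈-++⁺ʳ (sf φ))
  truth (φ ⋁ ψ) i a = mk⇔ (Sum.map (to (ihφ a)) (to (ihψ a))) (Sum.map (from (ihφ a)) (from (ihψ a)))
    where
    ihφ = truth φ (i ∘ there ∘ ∈-++⁺ˡ)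
    ihψ = truth ψ (i ∘ there ∘ ∈-++⁺ʳ (sf φ))
  truth (φ ⇒ ψ) i a = mk⇔
    (λ s v a≼v t → let b = point (≼-trans (root≼world a) a≼v) in
      to (ihψ b) (s b (mk≼ᶠ ≈-refl (≼⇒≲ a≼v)) (from (ihφ b) t)))
    (λ s b (mk≼ᶠ _ a≲b) t → from (ihψ b) (a≲b _ (i (here refl)) s (world b) ≼-refl (to (ihφ b) t)))
    where
    ihφ = truth φ (i ∘ there ∘ ∈-++⁺ˡ)
    ihψ = truth ψ (i ∘ there ∘ ∈-++⁺ʳ (sf φ))
  truth (◇ φ) i a = mk⇔ {A = Sat frameᶠ valuationᶠ a (◇ φ)}
    (λ s u a≼u → let b = point (≼-trans (root≼world a) a≼u)
                     c , b⊑c , t = s b (mk≼ᶠ ≈-refl (≼⇒≲ a≼u)) in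
      -- A chain of steps need not contain a ⊑-path of `F`, so `◇ φ` is established at the end of
      -- the chain and carried back.
      ◇-backward φ (i (here refl)) b⊑c (◇-intro Val φ ⊑-refl (to (ih c) t)) u ≼-refl)
    (λ s b (mk≼ᶠ _ a≲b) →
      let v , b⊑v , t = a≲b _ (i (here refl)) s (world b) ≼-refl
          -- The witness `v` needs a root seen from the root of `b`.
          y , r⊑y , y≼v = forthDown (root≼world b) b⊑v
      in point y≼v , ⊑⇒Step (root≼world b) y≼v r⊑y b⊑v ◅ ε , from (ih (point y≼v)) t)
    where ih = truth φ (i ∘ there)
  truth (□ φ) i a = mk⇔
    (λ s u v a≼u u⊑v →
      let ru = ≼-trans (root≼world a) a≼u
          y , r⊑y , y≼v = forthDown ru u⊑v
      in to (ih (point y≼v)) (s (point ru) (point y≼v) (mk≼ᶠ ≈-refl (≼⇒≲ a≼u)) (⊑⇒Step ru y≼v r⊑y u⊑v ◅ ε)))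
    (λ s b c (mk≼ᶠ _ a≲b) b⊑c → from (ih c)
      (□-forward φ (i (here refl)) b⊑c (a≲b _ (i (here refl)) s) (world c) (world c) ≼-refl ⊑-refl))
    where ih = truth φ (i ∘ there)

-- Invariance of truth under equivalence of models

module Transfer
  {W W' : Set} (F : Frame W) (F' : Frame W') (Val : Valuation F) (Val' : Valuation F')
  (f : W' → W) (g : W → W')
  (≼⇔ : ∀ a b → Frame._≼_ F' a b ⇔ Frame._≼_ F (f a) (f b))
  (⊑⇔ : ∀ a b → Frame._⊑_ F' a b ⇔ Frame._⊑_ F (f a) (f b))
  (⊥⇔ : ∀ a → Frame.W⊥ F' a ⇔ Frame.W⊥ F (f a))
  (fg≼ : ∀ w → Frame._≼_ F (f (g w)) w) (≼fg : ∀ w → Frame._≼_ F w (f (g w)))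
  (fg⊑ : ∀ w → Frame._⊑_ F (f (g w)) w) (⊑fg : ∀ w → Frame._⊑_ F w (f (g w)))
  where
  open Frame F

  private
    ≼g : ∀ {a w} → f a ≼ w → Frame._≼_ F' a (g w)
    ≼g l = from (≼⇔ _ _) (≼-trans l (≼fg _))

  -- `f (g w)` need not equal `w`: being related to it both ways by ≼ and ⊑ suffices, as persistence
  -- moves truth between them.
  transfer : ∀ φ → (∀ {x} → var x ∈ sf φ → ∀ a → Valuation.V Val' x a ⇔ Valuation.V Val x (f a)) →
             ∀ a → Sat F' Val' a φ ⇔ Sat F Val (f a) φ
  transfer (var x) v a = v (here refl) a
  transfer fbot    v a = ⊥⇔ a
  transfer (φ ⋀ ψ) v a =
    mk⇔ (λ (s , t) → to (ihφ a) s , to (ihψ a) t) (λ (s , t) → from (ihφ a) s , from (ihψ a) t)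
    where
    ihφ = transfer φ (v ∘ there ∘ ∈-++⁺ˡ)
    ihψ = transfer ψ (v ∘ there ∘ ∈-++⁺ʳ (sf φ))
  transfer (φ ⋁ ψ) v a = mk⇔ (Sum.map (to (ihφ a)) (to (ihψ a))) (Sum.map (from (ihφ a)) (from (ihψ a)))
    where
    ihφ = transfer φ (v ∘ there ∘ ∈-++⁺ˡ)
    ihψ = transfer ψ (v ∘ there ∘ ∈-++⁺ʳ (sf φ))
  transfer (φ ⇒ ψ) v a = mk⇔
    (λ s w l t → persistent F Val ψ (fg≼ w) (to (ihψ (g w))
      (s (g w) (≼g l) (from (ihφ (g w)) (persistent F Val φ (≼fg w) t)))))
    (λ s b l t → from (ihψ b) (s (f b) (to (≼⇔ a b) l) (to (ihφ b) t)))
    where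
    ihφ = transfer φ (v ∘ there ∘ ∈-++⁺ˡ)
    ihψ = transfer ψ (v ∘ there ∘ ∈-++⁺ʳ (sf φ))
  transfer (◇ φ) v a = mk⇔ {A = Sat F' Val' a (◇ φ)} {B = Sat F Val (f a) (◇ φ)}
    (λ s u l → let c , m , t = s (g u) (≼g l) in
      f c , ⊑-trans (⊑fg u) (to (⊑⇔ (g u) c) m) , to (ih c) t)
    (λ s b l → let w , m , t = s (f b) (to (≼⇔ a b) l) in
      g w , from (⊑⇔ b (g w)) (⊑-trans m (⊑fg w)) , from (ih (g w)) (persistent F Val φ (≼fg w) t))
    where ih = transfer φ (v ∘ there)
  transfer (□ φ) v a = mk⇔
    (λ s u w l m → persistent F Val φ (fg≼ w) (to (ih (g w))
      (s (g u) (g w) (≼g l) (from (⊑⇔ (g u) (g w)) (⊑-trans (fg⊑ u) (⊑-trans m (⊑fg w)))))))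
    (λ s b c l m → from (ih c) (s (f b) (f c) (to (≼⇔ a b) l) (to (⊑⇔ b c) m)))
    where ih = transfer φ (v ∘ there)

-- Finite models coded by numbers

infix 4 _∋_

_∋_ : ∀ {n} → Fin (2 ^ n) → Fin n → Set
c ∋ i = finToFun c i ≡ suc zero

-- The record keeps both dimensions in the type; the number `2 ^ (m * n)` does not determine them.
record BitMatrix (m n : ℕ) : Set where
  constructor matrix
  field entries : Fin (2 ^ (m * n))
open BitMatrix

allMatrices? : ∀ {m n} {P : BitMatrix m n → Set} → (∀ c → Dec (P c)) → Dec (∀ c → P c)
allMatrices? P? = map′ (λ h c → h (entries c)) (λ h c → h (matrix c)) (all? (P? ∘ matrix))

bit : ∀ {m n} → BitMatrix m n → Fin m → Fin n → Set
bit c i j = entries c ∋ combine i j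

bit? : ∀ {m n} (c : BitMatrix m n) i j → Dec (bit c i j)
bit? c i j = finToFun (entries c) (combine i j) ≟ suc zero

module Encode (lem : LEM) where

  private
    toBit : {A : Set} → Dec A → Fin 2
    toBit (yes _) = suc zero
    toBit (no _)  = zero

    toBit⇔ : {A : Set} (a? : Dec A) → toBit a? ≡ suc zero ⇔ A
    toBit⇔ (yes a) = mk⇔ (λ _ → a) (λ _ → refl)
    toBit⇔ (no ¬a) = mk⇔ (λ ()) (⊥-elim ∘ ¬a)

  -- Coding an arbitrary predicate takes excluded middle; searching through all codes does not.
  encode : ∀ {n} → (Fin n → Set) → Fin (2 ^ n)
  encode P = funToFin (λ i → toBit (lem (P i)))

  encode⇔ : ∀ {n} (P : Fin n → Set) i → encode P ∋ i ⇔ P i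
  encode⇔ P i = mk⇔
    (λ e → to (toBit⇔ (lem (P i))) (trans (sym (finToFun-funToFin _ i)) e))
    (λ p → trans (finToFun-funToFin _ i) (from (toBit⇔ (lem (P i))) p))

  encode-reflects : ∀ {n} {P Q : Fin n → Set} → encode P ≡ encode Q → ∀ {i} → P i → Q i
  encode-reflects {P = P} {Q} e {i} x = to (encode⇔ Q i) (≡-subst (_∋ i) e (from (encode⇔ P i) x))

  encodeMatrix : ∀ {m n} → (Fin m → Fin n → Set) → BitMatrix m n
  encodeMatrix {n = n} R = matrix (encode (uncurry R ∘ remQuot n))

  encodeMatrix⇔ : ∀ {m n} (R : Fin m → Fin n → Set) i j → bit (encodeMatrix R) i j ⇔ R i j
  encodeMatrix⇔ {n = n} R i j =
    ≡-subst (λ ij → bit (encodeMatrix R) i j ⇔ uncurry R ij) (remQuot-combine i j)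
      (encode⇔ (uncurry R ∘ remQuot n) (combine i j))

module _ {n : ℕ} (F : Frame (Fin n)) (Val : Valuation F)
  (⊥? : ∀ i → Dec (Frame.W⊥ F i)) (≼? : ∀ i j → Dec (Frame._≼_ F i j))
  (⊑? : ∀ i j → Dec (Frame._⊑_ F i j)) (V? : ∀ x i → Dec (Valuation.V Val x i)) where

  sat? : ∀ φ i → Dec (Sat F Val i φ)
  sat? (var x) i = V? x i
  sat? fbot    i = ⊥? i
  sat? (φ ⋀ ψ) i = sat? φ i ×-dec sat? ψ i
  sat? (φ ⋁ ψ) i = sat? φ i ⊎-dec sat? ψ i
  sat? (φ ⇒ ψ) i = all? λ j → ≼? i j →-dec (sat? φ j →-dec sat? ψ j)
  sat? (◇ φ)   i = all? λ j → ≼? i j →-dec any? λ l → ⊑? j l ×-dec sat? φ l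
  sat? (□ φ)   i = all? λ j → all? λ l → ≼? i j →-dec (⊑? j l →-dec sat? φ l)

module Coded (n k : ℕ) (r s : BitMatrix n n) (v : BitMatrix k n) where

  private
    _≼_ _⊑_ : Fin n → Fin n → Set
    _≼_ = bit r
    _⊑_ = bit s

    _≼?_ : ∀ i j → Dec (i ≼ j)
    _≼?_ = bit? r

    _⊑?_ : ∀ i j → Dec (i ⊑ j)
    _⊑?_ = bit? s

  Conditions : Set
  Conditions =
    (∀ i → i ≼ i) × (∀ i j l → i ≼ j → j ≼ l → i ≼ l) ×
    (∀ i → i ⊑ i) × (∀ i j l → i ⊑ j → j ⊑ l → i ⊑ l) ×
    (∀ y i j → i ≼ j → bit v y i → bit v y j) ×
    (∀ i j l → i ≼ j → i ⊑ l → ∃[ m ] (l ≼ m × j ⊑ m)) ×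
    (∀ i j l → i ⊑ j → j ≼ l → ∃[ m ] (i ≼ m × m ⊑ l)) ×
    (∀ i j l → i ≼ j → j ⊑ l → ∃[ m ] (i ⊑ m × m ≼ l)) ×
    (∀ i j l → i ≼ j → i ≼ l → j ≼ l ⊎ l ≼ j)

  conditions? : Dec Conditions
  conditions? =
    all? (λ i → i ≼? i) ×-dec
    all? (λ i → all? λ j → all? λ l → i ≼? j →-dec j ≼? l →-dec i ≼? l) ×-dec
    all? (λ i → i ⊑? i) ×-dec
    all? (λ i → all? λ j → all? λ l → i ⊑? j →-dec j ⊑? l →-dec i ⊑? l) ×-dec
    all? (λ y → all? λ i → all? λ j → i ≼? j →-dec bit? v y i →-dec bit? v y j) ×-dec
    all? (λ i → all? λ j → all? λ l → i ≼? j →-dec i ⊑? l →-dec any? λ m → l ≼? m ×-dec j ⊑? m) ×-dec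
    all? (λ i → all? λ j → all? λ l → i ⊑? j →-dec j ≼? l →-dec any? λ m → i ≼? m ×-dec m ⊑? l) ×-dec
    all? (λ i → all? λ j → all? λ l → i ≼? j →-dec j ⊑? l →-dec any? λ m → i ⊑? m ×-dec m ≼? l) ×-dec
    all? (λ i → all? λ j → all? λ l → i ≼? j →-dec i ≼? l →-dec (j ≼? l ⊎-dec l ≼? j))

  module _ (c : Conditions) where

    frame : Frame (Fin n)
    frame = let ≼-refl , ≼-trans , ⊑-refl , ⊑-trans , _ = c in record
      { W⊥ = λ _ → ⊥ ; _≼_ = _≼_ ; _⊑_ = _⊑_
      ; ≼-refl = ≼-refl _ ; ≼-trans = ≼-trans _ _ _
      ; ⊑-refl = ⊑-refl _ ; ⊑-trans = ⊑-trans _ _ _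
      ; W⊥-≼ = λ _ () ; W⊥-⊑ = λ _ () }

    isGS4c : IsGS4cFrame frame
    isGS4c = let _ , _ , _ , _ , _ , fu , bu , fd , ul = c in
      (λ _ ()) , fu _ _ _ , bu _ _ _ , fd _ _ _ , ul _ _ _

    valuation : Valuation frame
    valuation = let _ , _ , _ , _ , v-mono , _ = c in record
      -- Variables with index at least `k` are false everywhere.
      { V      = λ x i → Σ[ y ∈ Fin k ] toℕ y ≡ x × bit v y i
      ; V-mono = λ i≼j (y , e , b) → y , e , v-mono y _ _ i≼j b
      ; V-⊥    = λ () }

  -- Vacuous for codes that violate `Conditions`, so the search can range over all codes.
  Valid : Fm → Set
  Valid φ = ∀ c i → Sat (frame c) (valuation c) i φ

  valid? : ∀ φ → Dec (Valid φ)
  valid? φ with conditions?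
  ... | no ¬c = yes λ c → ⊥-elim (¬c c)
  ... | yes c with all? (sat? (frame c) (valuation c) (λ _ → no λ ()) _≼?_ _⊑?_
                           (λ x i → any? λ y → (toℕ y ≟ℕ x) ×-dec bit? v y i) φ)
  ...   | no ¬a = no λ a → ¬a (a c)
  ...   | yes a = yes λ c' i → to (transfer c' i) (a i)
    where
    ≡⇔ : {A : Set} → A ⇔ A
    ≡⇔ = mk⇔ id id
    -- Frames built from different proofs of `Conditions` have the same relations, so truth agrees
    -- along the identity.
    transfer : ∀ c' i → Sat (frame c) (valuation c) i φ ⇔ Sat (frame c') (valuation c') i φ
    transfer c' = Transfer.transfer (frame c') (frame c) (valuation c') (valuation c) id id
      (λ _ _ → ≡⇔) (λ _ _ → ≡⇔) (λ _ → ≡⇔)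
      (λ _ → Frame.≼-refl (frame c')) (λ _ → Frame.≼-refl (frame c'))
      (λ _ → Frame.⊑-refl (frame c')) (λ _ → Frame.⊑-refl (frame c')) φ (λ _ _ → ≡⇔)

modelSize : Fm → ℕ
modelSize φ = 2 ^ (2 ^ length (sf φ)) * 2 ^ length (sf φ)

ValidOnCodes : Fm → Set
ValidOnCodes φ = ∀ (r s : BitMatrix (modelSize φ) (modelSize φ)) (v : BitMatrix (varBound φ) (modelSize φ)) →
  Coded.Valid (modelSize φ) (varBound φ) r s v φ

validOnCodes? : ∀ φ → Dec (ValidOnCodes φ)
validOnCodes? φ = allMatrices? λ r → allMatrices? λ s → allMatrices? λ v →
  Coded.valid? (modelSize φ) (varBound φ) r s v φ

-- The filtration as a coded model of fixed size

module FiniteModel (lem : LEM) {W : Set} (F : Frame W) (isG : IsGS4cFrame F) (Val : Valuation F)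
  (φ : Fm) (w₀ : W) where
  open Frame F using (_≼_; ≼-refl)
  open Filtration F isG Val (sf φ)
  open Point
  open Encode lem

  label : W → Fin (2 ^ length (sf φ))
  label u = encode λ i → u ⊨ lookup (sf φ) i

  label⇒≲ : ∀ {u v} → label u ≡ label v → u ≲ v
  label⇒≲ {u} {v} e ψ i m =
    ≡-subst (v ⊨_) (sym (lookup-index i))
      (encode-reflects e {index i} (≡-subst (u ⊨_) (lookup-index i) m))

  label⇒~ : ∀ {u v} → label u ≡ label v → u ~ v
  label⇒~ e = label⇒≲ e , label⇒≲ (sym e)

  coneLabel : W → Fin (2 ^ (2 ^ length (sf φ)))
  coneLabel x = encode λ t → ∃[ u ] (x ≼ u × label u ≡ t)

  coneLabel⇒Covers : ∀ {x y} → coneLabel x ≡ coneLabel y → Covers x y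
  coneLabel⇒Covers e {u} xu =
    let v , yv , lv = encode-reflects e {label u} (u , xu , refl) in v , yv , label⇒~ (sym lv)

  code : Point → Fin (modelSize φ)
  code a = combine (coneLabel (root a)) (label (world a))

  code⇒≅ : ∀ {a b} → code a ≡ code b → a ≅ b
  code⇒≅ e =
    let c , l = combine-injective _ _ _ _ e in
    mk≅ (coneLabel⇒Covers c , coneLabel⇒Covers (sym c)) (label⇒~ l)

  decode : Fin (modelSize φ) → Point
  decode i with lem (∃[ a ] code a ≡ i)
  ... | yes (a , _) = a
  -- Codes of no point become copies of a default point, so the model has exactly `modelSize φ`
  -- worlds.
  ... | no _        = point (≼-refl {w₀})

  decode-code : ∀ a → decode (code a) ≅ a
  decode-code a with lem (∃[ b ] code b ≡ code a)
  ... | yes (_ , e) = code⇒≅ e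
  ... | no n        = ⊥-elim (n (a , refl))

  ≼-code ⊑-code : BitMatrix (modelSize φ) (modelSize φ)
  ≼-code = encodeMatrix λ i j → decode i ≼ᶠ decode j
  ⊑-code = encodeMatrix λ i j → decode i ⊑ᶠ decode j

  V-code : BitMatrix (varBound φ) (modelSize φ)
  V-code = encodeMatrix λ y i → Valuation.V valuationᶠ (toℕ y) (decode i)

  private
    ≼-code⇔ : ∀ i j → bit ≼-code i j ⇔ decode i ≼ᶠ decode j
    ≼-code⇔ = encodeMatrix⇔ _
    ⊑-code⇔ : ∀ i j → bit ⊑-code i j ⇔ decode i ⊑ᶠ decode j
    ⊑-code⇔ = encodeMatrix⇔ _
    V-code⇔ : ∀ y i → bit V-code y i ⇔ Valuation.V valuationᶠ (toℕ y) (decode i)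
    V-code⇔ = encodeMatrix⇔ _

    dc≼ : ∀ a → decode (code a) ≼ᶠ a
    dc≼ a = ≅⇒≼ᶠ (decode-code a)
    ≼dc : ∀ a → a ≼ᶠ decode (code a)
    ≼dc a = ≅⇒≼ᶠ (≅-sym (decode-code a))
    dc⊑ : ∀ a → decode (code a) ⊑ᶠ a
    dc⊑ a = ≅⇒Step (decode-code a) ◅ ε
    ⊑dc : ∀ a → a ⊑ᶠ decode (code a)
    ⊑dc a = ≅⇒Step (≅-sym (decode-code a)) ◅ ε

  open Coded (modelSize φ) (varBound φ) ≼-code ⊑-code V-code

  conditions : Conditions
  conditions =
    (λ i → from (≼-code⇔ i i) (Frame.≼-refl frameᶠ {decode i})) ,
    (λ i j l x y → from (≼-code⇔ i l) (≼ᶠ-trans (to (≼-code⇔ i j) x) (to (≼-code⇔ j l) y))) ,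
    (λ i → from (⊑-code⇔ i i) ε) ,
    (λ i j l x y → from (⊑-code⇔ i l) (to (⊑-code⇔ i j) x ◅◅ to (⊑-code⇔ j l) y)) ,
    (λ y i j x m → from (V-code⇔ y j) (Valuation.V-mono valuationᶠ {toℕ y} (to (≼-code⇔ i j) x) (to (V-code⇔ y i) m))) ,
    -- Each confluence witness is replaced by its code, which decodes to a point related to it both
    -- ways.
    (λ i j l x y → let a , la , ja = forthUpᶠ (to (≼-code⇔ i j) x) (to (⊑-code⇔ i l) y) in code a ,
      from (≼-code⇔ l (code a)) (≼ᶠ-trans la (≼dc a)) , from (⊑-code⇔ j (code a)) (ja ◅◅ ⊑dc a)) ,
    (λ i j l x y → let a , ia , al = backUpᶠ (to (⊑-code⇔ i j) x) (to (≼-code⇔ j l) y) in code a ,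
      from (≼-code⇔ i (code a)) (≼ᶠ-trans ia (≼dc a)) , from (⊑-code⇔ (code a) l) (dc⊑ a ◅◅ al)) ,
    (λ i j l x y → let a , ia , al = forthDownᶠ (to (≼-code⇔ i j) x) (to (⊑-code⇔ j l) y) in code a ,
      from (⊑-code⇔ i (code a)) (ia ◅◅ ⊑dc a) , from (≼-code⇔ (code a) l) (≼ᶠ-trans (dc≼ a) al)) ,
    (λ i j l x y → Sum.map (from (≼-code⇔ j l)) (from (≼-code⇔ l j))
      (linearᶠ {decode i} {decode j} {decode l} (to (≼-code⇔ i j) x) (to (≼-code⇔ i l) y)))

  private
    var⇔ : ∀ {x} → var x ∈ sf φ → ∀ i →
           (Σ[ y ∈ Fin (varBound φ) ] toℕ y ≡ x × bit V-code y i) ⇔ Valuation.V valuationᶠ x (decode i)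
    var⇔ {x} x∈φ i = mk⇔ (λ { (y , refl , b) → to (V-code⇔ y i) b }) λ m →
      fromℕ< x< , toℕ-fromℕ< x< ,
      from (V-code⇔ _ i) (≡-subst (λ z → Valuation.V valuationᶠ z (decode i)) (sym (toℕ-fromℕ< x<)) m)
      where x< = var<varBound φ x∈φ

  root₀ : Fin (modelSize φ)
  root₀ = code (point (≼-refl {w₀}))

  truth₀ : ∀ c → Sat (frame c) (valuation c) root₀ φ ⇔ w₀ ⊨ φ
  truth₀ c = mk⇔
    (λ t → to (truth φ id a) (persistent frameᶠ valuationᶠ φ (dc≼ a) (to (transfer root₀) t)))
    (λ t → from (transfer root₀) (persistent frameᶠ valuationᶠ φ (≼dc a) (from (truth φ id a) t)))
    where
    a = point (≼-refl {w₀})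
    transfer = Transfer.transfer frameᶠ (frame c) valuationᶠ (valuation c) decode code
      ≼-code⇔ ⊑-code⇔ (λ _ → mk⇔ id id) dc≼ ≼dc dc⊑ ⊑dc φ var⇔

  finitelyFalsifiable : ¬ w₀ ⊨ φ → OnSomeFiniteGS4cFrame Falsifiable φ
  finitelyFalsifiable n = modelSize φ , frame conditions , isGS4c conditions ,
    valuation conditions , root₀ , id , n ∘ to (truth₀ conditions)

  finitelySatisfiable : w₀ ⊨ φ → OnSomeFiniteGS4cFrame Satisfiable φ
  finitelySatisfiable t = modelSize φ , frame conditions , isGS4c conditions ,
    valuation conditions , root₀ , id , from (truth₀ conditions) t

  validOnCodes⇒⊨ : ValidOnCodes φ → w₀ ⊨ φ
  validOnCodes⇒⊨ valid = to (truth₀ conditions) (valid ≼-code ⊑-code V-code conditions root₀)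

-- Finite frame property and decidability

finiteFrameProperty : LEM → FiniteFrameProperty
finiteFrameProperty lem =
  (λ φ (W , F , isG , Val , w , _ , n) → FiniteModel.finitelyFalsifiable lem F isG Val φ w n) ,
  (λ φ (W , F , isG , Val , w , _ , t) → FiniteModel.finitelySatisfiable lem F isG Val φ w t)

complete : LEM → ∀ {φ} → ValidOnCodes φ → GS4c φ
complete lem {φ} valid = decidable-stable (lem (GS4c φ)) λ n →
  let Val , Γ , _ , ¬s = Canonical.falsifiable lem n
  in ¬s (FiniteModel.validOnCodes⇒⊨ lem (Canonical.frame lem) (Canonical.isGS4c lem) Val φ Γ valid)

validOnCodes : LEM → ∀ {φ} → GS4c φ → ValidOnCodes φ
validOnCodes lem {φ} d r s v c =
  Soundness.sound lem (frame c) (isGS4c c) d (valuation c)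
  where open Coded (modelSize φ) (varBound φ) r s v

does⇒ : {A : Set} (a? : Dec A) → does a? ≡ true → A
does⇒ (yes a) _ = a

mainTheorem3 : (LEM → FiniteFrameProperty) × Σ (Fm → Bool) DecidesGS4c
-- The Boolean function is given without excluded middle and so computes; only its correctness is
-- classical.
mainTheorem3 = finiteFrameProperty , (λ φ → does (validOnCodes? φ)) , λ lem φ →
  (λ e → complete lem (does⇒ (validOnCodes? φ) e)) ,
  (λ d → dec-true (validOnCodes? φ) (validOnCodes lem d))
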